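{- For every $n \ge 8$, every CNF encoding of $\mathsf{AtMostOne}(x_1,\dots,x_n)$ has at least $2n + \sqrt{n+1} - 2$ clauses.
   Context: $\mathsf{AtMostOne}(x_1,\dots,x_n)$ is true iff at most one of $x_1,\dots,x_n$ is true. A CNF formula is a set of clauses; its size is its number of clauses. For a partial assignment $\tau$ and CNF $\varphi$, $\varphi|_\tau$ is obtained by deleting every clause satisfied by $\tau$ and deleting from the remaining clauses every literal falsified by $\tau$. A CNF $\varphi$ over variables $X\sqcup Y$, $X=(x_1,\dots,x_n)$, encodes $f$ if for every assignment $\tau$ of $X$, $f(\tau(x_1),\dots,\tau(x_n))=\top$ iff $\varphi|_\tau$ is satisfiable; $Y$ is an arbitrary set of auxiliary variables. No propagation property is assumed. -}

module Defs where

open import Data.Bool using (Bool; true; false; not; T)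
open import Data.Fin using (Fin)
open import Data.Nat using (ℕ; _≤_; _+_; _*_; _∸_; suc)
open import Data.List using (List; length; filterᵇ; map; mapMaybe)
open import Data.Bool.ListAction using (any)
open import Data.List.Membership.Propositional using (_∈_)
open import Data.List.Relation.Unary.All using (All)
open import Data.List.Relation.Unary.Any using (Any)
open import Data.List.Relation.Unary.AllPairs using (AllPairs)
open import Data.Maybe using (Maybe; just; nothing)
open import Data.Product using (Σ; _×_)
open import Data.Sum using (_⊎_; inj₁; inj₂)
open import Relation.Binary.PropositionalEquality using (_≡_)
open import Relation.Nullary using (¬_)
open import Function.Bundles using (_⇔_)

data Lit (V : Set) : Set where
  pos : V → Lit V
  neg : V → Lit V

-- A clause is a (finite) set of literals, represented by a list
Clause : Set → Set
Clause V = List (Lit V)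

CNF : Set → Set
CNF V = List (Clause V)

SameClause : {V : Set} → Clause V → Clause V → Set
SameClause C D = (∀ l → l ∈ C → l ∈ D) × (∀ l → l ∈ D → l ∈ C)

IsClauseSet : {V : Set} → CNF V → Set
IsClauseSet φ = AllPairs (λ C D → ¬ SameClause C D) φ

size : {V : Set} → CNF V → ℕ
size = length

evalLit : {V : Set} → (V → Bool) → Lit V → Bool
evalLit σ (pos v) = σ v
evalLit σ (neg v) = not (σ v)

-- Variables: X = Fin n (main), Y = Fin m (auxiliary)
Var : ℕ → ℕ → Set
Var n m = Fin n ⊎ Fin m

satX : {n m : ℕ} → (Fin n → Bool) → Lit (Var n m) → Bool
satX τ (pos (inj₁ i)) = τ i
satX τ (neg (inj₁ i)) = not (τ i)
satX τ (pos (inj₂ _)) = false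
satX τ (neg (inj₂ _)) = false

yLit : {n m : ℕ} → Lit (Var n m) → Maybe (Lit (Fin m))
yLit (pos (inj₁ _)) = nothing
yLit (neg (inj₁ _)) = nothing
yLit (pos (inj₂ j)) = just (pos j)
yLit (neg (inj₂ j)) = just (neg j)

restrict : {n m : ℕ} → CNF (Var n m) → (Fin n → Bool) → CNF (Fin m)
restrict φ τ = map (mapMaybe yLit) (filterᵇ (λ C → not (any (satX τ) C)) φ)

Satisfiable : {V : Set} → CNF V → Set
Satisfiable φ = Σ (_ → Bool) (λ σ → All (λ C → Any (λ l → T (evalLit σ l)) C) φ)

AtMostOne : {n : ℕ} → (Fin n → Bool) → Set
AtMostOne τ = ∀ i j → τ i ≡ true → τ j ≡ true → i ≡ j

Encodes : {n m : ℕ} → CNF (Var n m) → ((Fin n → Bool) → Set) → Set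
Encodes {n} φ f = (τ : Fin n → Bool) → f τ ⇔ Satisfiable (restrict φ τ)

-- s ≥ 2n + √(n+1) − 2  (over the reals), for natural s, is equivalent to
-- 2n ≤ s + 2  and  n + 1 ≤ (s + 2 − 2n)²
AtLeastBound : ℕ → ℕ → Set
AtLeastBound n s = (2 * n ≤ s + 2) × (suc n ≤ (s + 2 ∸ 2 * n) * (s + 2 ∸ 2 * n))

{-# OPTIONS --safe #-}

-- Consider more generally CNFs φ with a list xs of input literals such that φ ⊨ AtMostOne xs and
-- each x ∈ xs is true in some model α x of φ. A clause containing ~ x may be shrunk to {~ x , l}
-- with l true in α x. Let N(x) be the number of clauses containing ~ x. N(x) = 0 is impossible:
-- flipping x in α k must falsify something. If N(x) = 1, with clause ~ x ∨ l, then l can take over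
-- the role of x, which saves a clause. If N(x) ≥ 3, dropping x removes 3 clauses. If all N(x) = 2
-- and two inputs x, z share a clause, dropping x (2 clauses) makes N(z) = 1, so a third clause is
-- saved. All these cases go by induction, since the bound grows by at most 3 with n.
--
-- Otherwise φ consists of clauses ~ x ∨ p x and ~ x ∨ q x for each x, and of r core clauses without
-- negated inputs. Fix an input k. Making x, p x and q x true in α k must falsify a clause C that is
-- in the core or one of the two clauses of k, and any l ∈ C true in α k has ~ l ∈ {p x , q x}. So
-- n − 1 ≤ (r + 2) D if every literal is a partner (p or q) of at most D inputs. A similar flip, in
-- the model of one of the inputs having a given partner, gives D ≤ max(2, r + 1).
module Submission where

open import Defs
open import Data.Bool using (Bool; true; false; not; T; T?)
open import Data.Bool.ListAction using (any)
open import Data.Bool.Properties using (T-≡)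
open import Data.Fin as Fin using (Fin)
import Data.Fin.Properties as Fin
open import Data.Nat using (ℕ; zero; suc; _+_; _*_; _∸_; _⊔_; _≤_; _<_; z≤n; s≤s; s≤s⁻¹; _≤?_; _≟_)
open import Data.Nat.Properties hiding (_≟_; _≤?_)
open import Data.List using (List; []; _∷_; [_]; _++_; length; map; filter; foldr; mapMaybe; allFin)
open import Data.List.Properties using (length-map; filter-all; length-tabulate; ≡-dec)
open import Data.List.Membership.Propositional using (_∈_; _∉_; find; lose)
open import Data.List.Membership.Propositional.Properties using (∈-filter⁺; ∈-filter⁻; ∈-map⁺; ∈-map⁻; ∈-++⁺ˡ; ∈-++⁺ʳ; ∈-++⁻; ∈-length)
open import Data.List.Relation.Unary.All as All using (All; []; _∷_; all?)
open import Data.List.Relation.Unary.All.Properties using (¬All⇒Any¬)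
import Data.List.Relation.Unary.Any.Properties as Any
open import Data.List.Relation.Unary.Any as Any using (Any; here; there; any?)
open import Data.List.Relation.Unary.AllPairs using ([]; _∷_)
open import Data.List.Relation.Unary.Unique.Propositional using (Unique)
open import Data.List.Relation.Unary.Unique.Propositional.Properties as Unique using ()
import Data.List.Relation.Binary.Sublist.Propositional.Properties as Sublist
open import Data.Product using (∃; _×_; _,_; proj₁; proj₂)
open import Data.Sum using (_⊎_; inj₁; inj₂; [_,_]′)
import Data.Sum.Properties as Sum
open import Data.Empty using (⊥; ⊥-elim)
open import Function using (_∘_; id)
open import Function.Bundles using (module Equivalence)
open import Relation.Binary.Definitions using (DecidableEquality)
open import Relation.Binary.PropositionalEquality using (_≡_; _≢_; refl; sym; trans; cong; subst; ≢-sym)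
open import Relation.Nullary using (¬_; Dec; does; yes; no; ¬?; _×-dec_; _⊎-dec_; contradiction)
open import Relation.Nullary.Decidable using (decidable-stable; dec-true; map′)
open import Relation.Unary using (Decidable)

-- Counting and covering in lists

count : {A : Set} {P : A → Set} → Decidable P → List A → ℕ
count P? = length ∘ filter P?

module _ {A : Set} {P Q R : A → Set} (P? : Decidable P) (Q? : Decidable Q) (R? : Decidable R) where

  count-⊎ : ∀ xs → (∀ {x} → x ∈ xs → R x → P x ⊎ Q x) → count R? xs ≤ count P? xs + count Q? xs
  count-⊎ [] _ = z≤n
  count-⊎ (x ∷ xs) h with R? x | P? x | Q? x | count-⊎ xs (h ∘ there)
  ... | no _  | no _  | no _  | ih = ih
  ... | no _  | no _  | yes _ | ih = ≤-trans ih (+-monoʳ-≤ (count P? xs) (n≤1+n _))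
  ... | no _  | yes _ | no _  | ih = m≤n⇒m≤1+n ih
  ... | no _  | yes _ | yes _ | ih = m≤n⇒m≤1+n (≤-trans ih (+-monoʳ-≤ (count P? xs) (n≤1+n _)))
  ... | yes _ | no _  | yes _ | ih = ≤-trans (s≤s ih) (≤-reflexive (sym (+-suc (count P? xs) _)))
  ... | yes _ | yes _ | no _  | ih = s≤s ih
  ... | yes _ | yes _ | yes _ | ih = s≤s (≤-trans ih (+-monoʳ-≤ (count P? xs) (n≤1+n _)))
  ... | yes r | no ¬p | no ¬q | _ = contradiction (h (here refl) r) [ ¬p , ¬q ]′

  count-disjoint : ∀ xs → (∀ {x} → x ∈ xs → P x → R x) → (∀ {x} → x ∈ xs → Q x → R x) →
    (∀ {x} → x ∈ xs → P x → ¬ Q x) → count P? xs + count Q? xs ≤ count R? xs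
  count-disjoint [] _ _ _ = z≤n
  count-disjoint (x ∷ xs) p⇒r q⇒r pq
    with R? x | P? x | Q? x | count-disjoint xs (p⇒r ∘ there) (q⇒r ∘ there) (pq ∘ there)
  ... | _     | yes p | yes q | _ = contradiction q (pq (here refl) p)
  ... | no ¬r | yes p | _     | _ = contradiction (p⇒r (here refl) p) ¬r
  ... | no ¬r | no _  | yes q | _ = contradiction (q⇒r (here refl) q) ¬r
  ... | no _  | no _  | no _  | ih = ih
  ... | yes _ | no _  | no _  | ih = m≤n⇒m≤1+n ih
  ... | yes _ | yes _ | no _  | ih = s≤s ih
  ... | yes _ | no _  | yes _ | ih = ≤-trans (≤-reflexive (+-suc (count P? xs) _)) (s≤s ih)

module _ {A : Set} {P Q : A → Set} (P? : Decidable P) (Q? : Decidable Q) where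

  count-mono : ∀ xs → (∀ {x} → x ∈ xs → P x → Q x) → count P? xs ≤ count Q? xs
  count-mono [] _ = z≤n
  count-mono (x ∷ xs) h with P? x | Q? x | count-mono xs (h ∘ there)
  ... | no _  | no _  | ih = ih
  ... | no _  | yes _ | ih = m≤n⇒m≤1+n ih
  ... | yes _ | yes _ | ih = s≤s ih
  ... | yes p | no ¬q | _  = contradiction (h (here refl) p) ¬q

count-complement : {A : Set} {P : A → Set} (P? : Decidable P) (xs : List A) →
  count P? xs + count (¬? ∘ P?) xs ≡ length xs
count-complement P? [] = refl
count-complement P? (x ∷ xs) with P? x
... | yes _ = cong suc (count-complement P? xs)
... | no _  = trans (+-suc (count P? xs) _) (cong suc (count-complement P? xs))

count-filter : {A : Set} {P Q : A → Set} (P? : Decidable P) (Q? : Decidable Q) (xs : List A) →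
  count P? (filter Q? xs) ≤ count P? xs
count-filter P? Q? xs =
  Sublist.length-mono-≤ (Sublist.filter⁺ P? P? (λ { refl → id }) (Sublist.filter-⊆ Q? xs))

-- Union bound, by induction on `cs`: at most `D` entries of `xs` are related to `c`, and the rest
-- are covered by the other members of `cs`.
cover : {A C : Set} {R : C → A → Set} (R? : ∀ c → Decidable (R c)) (D : ℕ) (cs : List C) (xs : List A) →
  (∀ {x} → x ∈ xs → ∃ λ c → c ∈ cs × R c x) → (∀ {c} → c ∈ cs → count (R? c) xs ≤ D) →
  length xs ≤ length cs * D
cover R? D [] [] _ _ = z≤n
cover R? D [] (x ∷ xs) hit _ with hit (here refl)
... | _ , () , _
cover R? D (c ∷ cs) xs hit bound = begin
  length xs                                ≡⟨ count-complement (R? c) xs ⟨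
  count (R? c) xs + length ys              ≤⟨ +-mono-≤ (bound (here refl)) (cover R? D cs ys hit′ bound′) ⟩
  D + length cs * D                        ∎
  where
  open ≤-Reasoning
  ys = filter (¬? ∘ R? c) xs
  hit′ : ∀ {x} → x ∈ ys → ∃ λ c′ → c′ ∈ cs × _
  hit′ x∈ with ∈-filter⁻ (¬? ∘ R? c) x∈
  ... | x∈xs , ¬r with hit x∈xs
  ... | _  , here refl , r = contradiction r ¬r
  ... | c′ , there c′∈ , r = c′ , c′∈ , r
  bound′ : ∀ {c′} → c′ ∈ cs → count (R? c′) ys ≤ D
  bound′ {c′} c′∈ = ≤-trans (count-filter (R? c′) (¬? ∘ R? c) xs) (bound (there c′∈))

unique-equal⇒≤1 : {A : Set} {xs : List A} → Unique xs → (∀ {x y} → x ∈ xs → y ∈ xs → x ≡ y) → length xs ≤ 1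
unique-equal⇒≤1 [] _ = z≤n
unique-equal⇒≤1 (_ ∷ []) _ = s≤s z≤n
unique-equal⇒≤1 ((x≢y ∷ _) ∷ _ ∷ _) eq = contradiction (eq (here refl) (there (here refl))) x≢y

nonempty : {A : Set} {xs : List A} → 3 ≤ length xs → ∃ (_∈ xs)
nonempty {xs = x ∷ _} _ = x , here refl

-- Deletion and choice over a type with decidable equality

module Delete {A : Set} (_≟ᴬ_ : DecidableEquality A) where

  open import Data.List.Membership.DecPropositional _≟ᴬ_ using (_∈?_) public

  infixl 6 _∖_
  _∖_ : List A → A → List A
  xs ∖ x = filter (λ y → ¬? (y ≟ᴬ x)) xs

  ∈-∖⁻ : ∀ {xs x y} → y ∈ xs ∖ x → y ∈ xs × y ≢ x
  ∈-∖⁻ = ∈-filter⁻ _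

  ∈-∖⁺ : ∀ {xs x y} → y ∈ xs → y ≢ x → y ∈ xs ∖ x
  ∈-∖⁺ = ∈-filter⁺ _

  unique-∖ : ∀ {xs x} → Unique xs → Unique (xs ∖ x)
  unique-∖ = Unique.filter⁺ _

  length-∖ : ∀ {xs} x → Unique xs → length xs ≤ suc (length (xs ∖ x))
  length-∖ x [] = z≤n
  length-∖ {y ∷ ys} x (y∉ ∷ u) with y ≟ᴬ x
  ... | no _     = s≤s (length-∖ x u)
  ... | yes refl = s≤s (≤-reflexive (cong length (sym (filter-all _ (All.map ≢-sym y∉)))))

  third : ∀ {xs} → Unique xs → 3 ≤ length xs → ∀ x y → ∃ λ z → z ∈ xs × z ≢ x × z ≢ y
  third {xs} u 3≤ x y with xs ∖ x ∖ y in eq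
  ... | z ∷ zs = let z∈ , z≢y = ∈-∖⁻ {xs ∖ x} (subst (z ∈_) (sym eq) (here refl))
                     z∈xs , z≢x = ∈-∖⁻ z∈
                 in z , z∈xs , z≢x , z≢y
  ... | [] = contradiction (≤-trans 3≤ (≤-trans (length-∖ x u) (s≤s (length-∖ y (unique-∖ u)))))
               (subst (λ zs → ¬ 3 ≤ suc (suc (length zs))) (sym eq) λ { (s≤s (s≤s ())) })

  -- Deciding membership frees `f` from a proof argument; the default `b` is the value off `xs`.
  choice : {B : Set} {P : A → B → Set} → B → (xs : List A) → (∀ {x} → x ∈ xs → ∃ (P x)) →
    ∃ λ (f : A → B) → ∀ {x} → x ∈ xs → P x (f x)
  choice {B} {P} b xs h = f , f-spec
    where
    f : A → B
    f x with x ∈? xs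
    ... | yes x∈ = proj₁ (h x∈)
    ... | no _   = b
    f-spec : ∀ {x} → x ∈ xs → P x (f x)
    f-spec {x} x∈ with x ∈? xs
    ... | yes x∈′ = proj₂ (h x∈′)
    ... | no x∉   = contradiction x∈ x∉

-- Arithmetic of the bound

-- Bound n s says s ≥ 2n + √(n+1) − 2 or s ≥ 3n − 7; u stands for s + 5 − 2n, which
-- is non-negative in all cases met.
Bound : ℕ → ℕ → Set
Bound n s = ∃ λ u → 2 * n + u ≤ s + 5 × (n ≤ u + 2 ⊎ suc n ≤ (u ∸ 3) * (u ∸ 3))

bound-weaken : ∀ {n n′ s s′} → n′ ≤ n → s ≤ s′ → Bound n s → Bound n′ s′
bound-weaken {s = s} {s′} n′≤n s≤s′ (u , 2n+u≤ , h) =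
  u , ≤-trans (+-monoˡ-≤ u (*-monoʳ-≤ 2 n′≤n)) (≤-trans 2n+u≤ (+-monoˡ-≤ 5 s≤s′)) ,
  [ inj₁ ∘ ≤-trans n′≤n , inj₂ ∘ ≤-trans (s≤s n′≤n) ]′ h

-- The witness `u` grows by one. The linear alternative grows with it, and raising the base of a
-- square by one adds at least one.
bound-suc : ∀ {n s} → Bound n s → Bound (suc n) (3 + s)
bound-suc {n} {s} (u , 2n+u≤ , h) = suc u , eq , [ inj₁ ∘ s≤s , inj₂ ∘ square u ]′ h
  where
  open ≤-Reasoning
  eq : 2 * suc n + suc u ≤ 3 + s + 5
  eq = begin
    2 * suc n + suc u     ≡⟨ cong (_+ suc u) (*-suc 2 n) ⟩
    2 + (2 * n + suc u)   ≡⟨ cong (2 +_) (+-suc (2 * n) u) ⟩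
    3 + (2 * n + u)       ≤⟨ +-monoʳ-≤ 3 2n+u≤ ⟩
    3 + s + 5             ∎
  square : ∀ u → suc n ≤ (u ∸ 3) * (u ∸ 3) → suc (suc n) ≤ (suc u ∸ 3) * (suc u ∸ 3)
  square (suc (suc (suc v))) n< = s≤s (≤-trans n< (≤-trans (*-monoʳ-≤ v (n≤1+n v)) (m≤n+m (v * suc v) v)))

bound-small : ∀ {n s} → n ≤ 2 → Bound n s
bound-small {n} {s} n≤2 =
  0 ,
  ≤-trans (≤-reflexive (+-identityʳ _)) (≤-trans (*-monoʳ-≤ 2 n≤2) (≤-trans (n≤1+n 4) (m≤n+m 5 s))) ,
  inj₁ n≤2

-- The witness is `5 + r`. For `r ≥ 1` the hypothesis reads n ≤ 1 + (r + 2)(r + 1), so n + 1 ≤ (r +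
-- 2)². For `r = 0` it only gives n ≤ 5, where the square may fail and the linear alternative steps
-- in.
bound-regular : ∀ {n s} r → 2 * n + r ≤ s → n ≤ suc ((2 + r) * (2 ⊔ suc r)) → Bound n s
bound-regular {n} {s} r 2n+r≤s n≤ = 5 + r , le , square r n≤
  where
  open ≤-Reasoning
  le : 2 * n + (5 + r) ≤ s + 5
  le = begin
    2 * n + (5 + r)   ≡⟨ cong (2 * n +_) (+-comm 5 r) ⟩
    2 * n + (r + 5)   ≡⟨ +-assoc (2 * n) r 5 ⟨
    2 * n + r + 5     ≤⟨ +-monoˡ-≤ 5 2n+r≤s ⟩
    s + 5             ∎
  square : ∀ r → n ≤ suc ((2 + r) * (2 ⊔ suc r)) → n ≤ 5 + r + 2 ⊎ suc n ≤ (2 + r) * (2 + r)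
  square zero n≤ = inj₁ (≤-trans n≤ (s≤s (s≤s (s≤s (s≤s (s≤s z≤n))))))
  square (suc t) n≤ = inj₂ (begin
    suc n                            ≤⟨ s≤s n≤ ⟩
    2 + (3 + t) * (2 + t)            ≤⟨ +-monoˡ-≤ _ (s≤s (s≤s (z≤n {suc t}))) ⟩
    3 + t + (3 + t) * (2 + t)        ≡⟨ *-suc (3 + t) (2 + t) ⟨
    (3 + t) * (3 + t)                ∎)

-- For n ≥ 8 the linear alternative implies the quadratic one: with `u = 3 + v` it says n ≤ v + 5,
-- so v ≥ 3 and n + 1 ≤ v + 6 ≤ 3v ≤ v².
bound⇒AtLeastBound : ∀ {n s} → 8 ≤ n → Bound n s → AtLeastBound n s
bound⇒AtLeastBound {n} {s} 8≤n (u , 2n+u≤ , h) = split u 2n+u≤ h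
  where
  open ≤-Reasoning
  split : ∀ u → 2 * n + u ≤ s + 5 → n ≤ u + 2 ⊎ suc n ≤ (u ∸ 3) * (u ∸ 3) → AtLeastBound n s
  split (suc (suc (suc v))) le h = ≤-trans (m≤m+n (2 * n) v) 2n+v≤ , ≤-trans (square h) (*-mono-≤ v≤ v≤)
    where
    2n+v≤ : 2 * n + v ≤ s + 2
    2n+v≤ = +-cancelʳ-≤ 3 _ _ (begin
      2 * n + v + 3     ≡⟨ +-assoc (2 * n) v 3 ⟩
      2 * n + (v + 3)   ≡⟨ cong (2 * n +_) (+-comm v 3) ⟩
      2 * n + (3 + v)   ≤⟨ le ⟩
      s + 5             ≡⟨ +-assoc s 2 3 ⟨
      s + 2 + 3         ∎)
    v≤ : v ≤ s + 2 ∸ 2 * n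
    v≤ = ≤-trans (≤-reflexive (sym (m+n∸m≡n (2 * n) v))) (∸-monoˡ-≤ (2 * n) 2n+v≤)
    square : n ≤ 3 + v + 2 ⊎ suc n ≤ v * v → suc n ≤ v * v
    square (inj₂ h) = h
    square (inj₁ h) = begin
      suc n             ≤⟨ s≤s h ⟩
      4 + v + 2         ≡⟨ +-comm (4 + v) 2 ⟩
      6 + v             ≡⟨ +-comm 6 v ⟩
      v + 2 * 3         ≤⟨ +-monoʳ-≤ v (*-monoʳ-≤ 2 3≤v) ⟩
      3 * v             ≤⟨ *-monoˡ-≤ v 3≤v ⟩
      v * v             ∎
      where
      3≤v : 3 ≤ v
      3≤v = +-cancelʳ-≤ 5 3 v (≤-trans 8≤n (≤-trans h (≤-reflexive (trans (+-comm (3 + v) 2) (+-comm 5 v)))))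
  split 0 _ (inj₁ h) = contradiction (≤-trans 8≤n h) λ { (s≤s (s≤s ())) }
  split 1 _ (inj₁ h) = contradiction (≤-trans 8≤n h) λ { (s≤s (s≤s (s≤s ()))) }
  split 2 _ (inj₁ h) = contradiction (≤-trans 8≤n h) λ { (s≤s (s≤s (s≤s (s≤s ())))) }
  split 0 _ (inj₂ ())
  split 1 _ (inj₂ ())
  split 2 _ (inj₂ ())

-- Literals, assignments and models

module _ {V : Set} (_≟ᵛ_ : DecidableEquality V) where

  infix 4 _≟ˡ_
  _≟ˡ_ : DecidableEquality (Lit V)
  pos v ≟ˡ pos w = map′ (cong pos) (λ { refl → refl }) (v ≟ᵛ w)
  neg v ≟ˡ neg w = map′ (cong neg) (λ { refl → refl }) (v ≟ᵛ w)
  pos _ ≟ˡ neg _ = no λ ()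
  neg _ ≟ˡ pos _ = no λ ()

  open Delete _≟ˡ_

  infix 9 ~_
  ~_ : Lit V → Lit V
  ~ pos v = neg v
  ~ neg v = pos v

  ~-involutive : ∀ l → ~ ~ l ≡ l
  ~-involutive (pos _) = refl
  ~-involutive (neg _) = refl

  ~-swap : ∀ {l l′} → l ≡ ~ l′ → ~ l ≡ l′
  ~-swap refl = ~-involutive _

  Assignment : Set
  Assignment = V → Bool

  -- A record, so that σ and l can be inferred from the type.
  infix 4 _⊨_ _⊨?_
  record _⊨_ (σ : Assignment) (l : Lit V) : Set where
    constructor sat
    field holds : T (evalLit σ l)

  _⊨?_ : ∀ σ → Decidable (σ ⊨_)
  σ ⊨? l = map′ sat _⊨_.holds (T? (evalLit σ l))

  consistent : ∀ {σ l} → σ ⊨ l → ¬ σ ⊨ ~ l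
  consistent {σ} {pos v} (sat p) (sat n) with σ v
  consistent {σ} {pos v} (sat p) (sat ()) | true
  consistent {σ} {pos v} (sat ()) (sat n) | false
  consistent {σ} {neg v} (sat n) (sat p) = consistent {σ} {pos v} (sat p) (sat n)

  complete : ∀ {σ} l → ¬ σ ⊨ l → σ ⊨ ~ l
  complete {σ} (pos v) ¬p with σ v in eq
  ... | true  = contradiction (sat (subst T (sym eq) _)) ¬p
  ... | false = sat (subst (T ∘ not) (sym eq) _)
  complete {σ} (neg v) ¬p with σ v in eq
  ... | true  = sat (subst T (sym eq) _)
  ... | false = contradiction (sat (subst (T ∘ not) (sym eq) _)) ¬p

  ⊨⇒≢~ : ∀ {σ l l′} → σ ⊨ l → σ ⊨ l′ → l ≢ ~ l′
  ⊨⇒≢~ p q refl = consistent q p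

  update : V → Bool → Assignment → Assignment
  update v b σ w with w ≟ᵛ v
  ... | yes _ = b
  ... | no _  = σ w

  assign : Lit V → Assignment → Assignment
  assign (pos v) = update v true
  assign (neg v) = update v false

  update-hit : ∀ v b σ → update v b σ v ≡ b
  update-hit v b σ with v ≟ᵛ v
  ... | yes _ = refl
  ... | no ¬p = contradiction refl ¬p

  update-miss : ∀ {v b σ w} → w ≢ v → update v b σ w ≡ σ w
  update-miss {v} {w = w} w≢v with w ≟ᵛ v
  ... | yes p = contradiction p w≢v
  ... | no _  = refl

  assign-self : ∀ l {σ} → assign l σ ⊨ l
  assign-self (pos v) {σ} = sat (subst T (sym (update-hit v true σ)) _)
  assign-self (neg v) {σ} = sat (subst (T ∘ not) (sym (update-hit v false σ)) _)

  assign-keep : ∀ l {σ l′} → l′ ≢ ~ l → σ ⊨ l′ → assign l σ ⊨ l′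
  assign-keep (pos v) {σ} {pos w} _ (sat p) with w ≟ᵛ v
  ... | yes refl = assign-self (pos v)
  ... | no w≢v   = sat (subst T (sym (update-miss w≢v)) p)
  assign-keep (neg v) {σ} {neg w} _ (sat p) with w ≟ᵛ v
  ... | yes refl = assign-self (neg v)
  ... | no w≢v   = sat (subst (T ∘ not) (sym (update-miss w≢v)) p)
  assign-keep (pos v) {l′ = neg w} ne (sat p) =
    sat (subst (T ∘ not) (sym (update-miss λ { refl → ne refl })) p)
  assign-keep (neg v) {l′ = pos w} ne (sat p) =
    sat (subst T (sym (update-miss λ { refl → ne refl })) p)

  assignAll : List (Lit V) → Assignment → Assignment
  assignAll ls σ = foldr assign σ ls

  assignAll-keep : ∀ ls {σ l} → ~ l ∉ ls → σ ⊨ l → assignAll ls σ ⊨ l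
  assignAll-keep [] _ p = p
  assignAll-keep (m ∷ ls) ne p =
    assign-keep m (λ e → ne (here (~-swap e))) (assignAll-keep ls (ne ∘ there) p)

  -- The common model `τ` rules out complementary literals in `ls`, so no assignment undoes another.
  assignAll-self : ∀ {τ ls σ l} → All (τ ⊨_) ls → l ∈ ls → assignAll ls σ ⊨ l
  assignAll-self {ls = m ∷ _} {l = l} (t ∷ ts) l∈ with l ≟ˡ m
  ... | yes refl = assign-self m
  assignAll-self (t ∷ ts) (here refl) | no ne = contradiction refl ne
  assignAll-self {ls = m ∷ _} (t ∷ ts) (there l∈) | no ne =
    assign-keep m (⊨⇒≢~ (All.lookup ts l∈) t) (assignAll-self ts l∈)

  Holds : Assignment → Clause V → Set
  Holds σ C = Any (σ ⊨_) C

  holds? : ∀ σ → Decidable (Holds σ)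
  holds? σ = any? (σ ⊨?_)

  Model : Assignment → CNF V → Set
  Model σ φ = All (Holds σ) φ

  falsified-clause : ∀ {σ φ} → ¬ Model σ φ → ∃ λ C → C ∈ φ × ¬ Holds σ C
  falsified-clause {σ} {φ} ¬m = find (¬All⇒Any¬ (holds? σ) φ ¬m)

  -- Elimination of a variable

  -- The effect on C of replacing the variable of x by the disjunction D (and the literal ~ x by its
  -- negation, which only matters for clauses that are dropped by eliminate).
  substitute : Lit V → Clause V → Clause V → Clause V
  substitute x D C with x ∈? C
  ... | yes _ = C ∖ x ++ D
  ... | no _  = C

  -- Used with `D` empty, which makes `x` false, and with `D = [ q ]` where `q` lies in every
  -- dropped clause: replacing `~ x` by `~ q` there would give tautologies.
  eliminate : Lit V → Clause V → CNF V → CNF V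
  eliminate x D φ = map (substitute x D) (filter (λ C → ¬? (~ x ∈? C)) φ)

  substitute-⊆ : ∀ {x C l} → l ∈ substitute x [] C → l ∈ C
  substitute-⊆ {x} {C} l∈ with x ∈? C
  ... | no _  = l∈
  ... | yes _ with ∈-++⁻ (C ∖ x) l∈
  ... | inj₁ l∈C = proj₁ (∈-∖⁻ l∈C)

  ∈-substitute : ∀ {x D C l} → l ∈ C → l ≢ x → l ∈ substitute x D C
  ∈-substitute {x} {D} {C} l∈ l≢x with x ∈? C
  ... | no _  = l∈
  ... | yes _ = ∈-++⁺ˡ (∈-∖⁺ l∈ l≢x)

  eliminate⁺ : ∀ {σ x D φ} → (σ ⊨ x → Holds σ D) → Model σ φ → Model σ (eliminate x D φ)
  eliminate⁺ {σ} {x} {D} {φ} x⇒D m = All.tabulate clause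
    where
    clause : ∀ {C} → C ∈ eliminate x D φ → Holds σ C
    clause C∈ with ∈-map⁻ (substitute x D) C∈
    ... | C , C∈′ , refl with find (All.lookup m (proj₁ (∈-filter⁻ _ C∈′)))
    ... | l , l∈ , σ⊨l with l ≟ˡ x
    ... | no l≢x = lose (∈-substitute l∈ l≢x) σ⊨l
    ... | yes refl with x ∈? C
    ... | no x∉ = contradiction l∈ x∉
    ... | yes _ = let d , d∈ , σ⊨d = find (x⇒D σ⊨l) in lose (∈-++⁺ʳ (C ∖ x) d∈) σ⊨d

  private
    kept : ∀ {σ x D φ C} → Model σ (eliminate x D φ) → C ∈ φ → ~ x ∉ C → Holds σ (substitute x D C)
    kept m C∈ ~x∉ = All.lookup m (∈-map⁺ _ (∈-filter⁺ _ C∈ ~x∉))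

  -- As `D` fails, each kept clause is satisfied by a literal other than `x`, which survives making
  -- `x` false. The dropped clauses hold by `~ x`.
  eliminate-false : ∀ {σ x D φ} → Model σ (eliminate x D φ) → ¬ Holds σ D → Model (assign (~ x) σ) φ
  eliminate-false {σ} {x} {D} {φ} m ¬D = All.tabulate clause
    where
    clause : ∀ {C} → C ∈ φ → Holds (assign (~ x) σ) C
    clause {C} C∈ with ~ x ∈? C
    ... | yes ~x∈ = lose ~x∈ (assign-self (~ x))
    ... | no ~x∉ with kept {D = D} m C∈ ~x∉
    ... | h with x ∈? C
    ... | no x∉ = let l , l∈ , σ⊨l = find h
                  in lose l∈ (assign-keep (~ x) (λ e → x∉ (subst (_∈ C) (trans e (~-involutive x)) l∈)) σ⊨l)
    ... | yes _ with find h
    ... | l , l∈ , σ⊨l with ∈-++⁻ (C ∖ x) l∈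
    ... | inj₂ l∈D = contradiction (lose l∈D σ⊨l) ¬D
    ... | inj₁ l∈C = let l∈ , l≢x = ∈-∖⁻ l∈C
                     in lose l∈ (assign-keep (~ x) (λ e → l≢x (trans e (~-involutive x))) σ⊨l)

  -- The dropped clauses hold by `q`. A kept clause either contains `x` or is unchanged, and then it
  -- has no `~ x` to lose.
  eliminate-true : ∀ {σ x q φ} → Model σ (eliminate x [ q ] φ) → σ ⊨ q → q ≢ ~ x →
    (∀ {C} → C ∈ φ → ~ x ∈ C → q ∈ C) → Model (assign x σ) φ
  eliminate-true {σ} {x} {q} {φ} m σ⊨q q≢~x q-in = All.tabulate clause
    where
    clause : ∀ {C} → C ∈ φ → Holds (assign x σ) C
    clause {C} C∈ with ~ x ∈? C
    ... | yes ~x∈ = lose (q-in C∈ ~x∈) (assign-keep x q≢~x σ⊨q)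
    ... | no ~x∉ with kept {D = [ q ]} m C∈ ~x∉
    ... | h with x ∈? C
    ... | yes x∈ = lose x∈ (assign-self x)
    ... | no _   = let l , l∈ , σ⊨l = find h
                   in lose l∈ (assign-keep x (λ e → ~x∉ (subst (_∈ C) e l∈)) σ⊨l)

  length-eliminate : ∀ {x} D φ → length (eliminate x D φ) ≡ count (λ C → ¬? (~ x ∈? C)) φ
  length-eliminate {x} D φ = length-map (substitute x D) (filter (λ C → ¬? (~ x ∈? C)) φ)

  -- Encodings, removal and replacement of inputs, and a normal form

  -- Arbitrary literals serve as inputs, so that auxiliary literals can take over the role of
  -- inputs; the all-false input is deliberately left unconstrained.
  record Encoding (φ : CNF V) (xs : List (Lit V)) (α : Lit V → Assignment) : Set where
    field
      unique : Unique xs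
      model  : ∀ {x} → x ∈ xs → Model (α x) φ
      self   : ∀ {x} → x ∈ xs → α x ⊨ x
      amo    : ∀ {σ x y} → Model σ φ → x ∈ xs → y ∈ xs → σ ⊨ x → σ ⊨ y → x ≡ y

    other : ∀ {x y} → x ∈ xs → y ∈ xs → x ≢ y → α x ⊨ ~ y
    other {x} {y} x∈ y∈ x≢y = complete y (λ p → x≢y (amo (model x∈) x∈ y∈ (self x∈) p))

    -- The model of a third input falsifies both `x` and `y`, which complementary literals do not
    -- allow.
    negation-free : 3 ≤ length xs → ∀ {x y} → x ∈ xs → y ∈ xs → x ≢ ~ y
    negation-free 3≤ {x} {y} x∈ y∈ x≡~y =
      let z , z∈ , z≢x , z≢y = third unique 3≤ x y
      in consistent (subst (α z ⊨_) (~-swap x≡~y) (other z∈ x∈ z≢x)) (other z∈ y∈ z≢y)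

  open Encoding
  -- The models of the other inputs falsify `x` and survive. Conversely, making `x` false in a model
  -- of the smaller formula gives a model of `φ` and keeps the other inputs that are true.
  drop-input : ∀ {φ xs α x} → Encoding φ xs α → x ∈ xs → Encoding (eliminate x [] φ) (xs ∖ x) α
  drop-input {xs = xs} {x = x} E x∈ = record
    { unique = unique-∖ (unique E)
    ; model  = λ y∈ → let y∈ , y≢x = ∈-∖⁻ y∈
                      in eliminate⁺ (λ p → contradiction (other E y∈ x∈ y≢x) (consistent p)) (model E y∈)
    ; self   = self E ∘ proj₁ ∘ ∈-∖⁻
    ; amo    = λ m y∈ z∈ p q →
        amo E (eliminate-false m λ ()) (proj₁ (∈-∖⁻ {xs} y∈)) (proj₁ (∈-∖⁻ {xs} z∈)) (keep y∈ p) (keep z∈ q)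
    }
    where
    keep : ∀ {σ y} → y ∈ xs ∖ x → σ ⊨ y → assign (~ x) σ ⊨ y
    keep y∈ = assign-keep (~ x) (λ e → proj₂ (∈-∖⁻ {xs} y∈) (trans e (~-involutive x)))

  -- The new input `q` inherits the model of `x`. For `amo`, a model with `q` true is extended by
  -- `x` true, so no other input can hold; a model with `q` false is extended by `x` false.
  replace-input : ∀ {φ xs α x q} → Encoding φ xs α → 3 ≤ length xs → x ∈ xs → α x ⊨ q →
    (∀ {C} → C ∈ φ → ~ x ∈ C → q ∈ C) → ∃ (Encoding (eliminate x [ q ] φ) (q ∷ xs ∖ x))
  replace-input {φ} {xs} {α} {x} {q} E 3≤ x∈ x⊨q q-in = β , record
    { unique = All.tabulate (λ y∈ e → fresh y∈ (sym e)) ∷ unique-∖ (unique E)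
    ; model  = model′
    ; self   = self′
    ; amo    = amo′
    }
    where
    β : Lit V → Assignment
    β y with y ≟ˡ q
    ... | yes _ = α x
    ... | no _  = α y
    fresh : ∀ {y} → y ∈ xs ∖ x → y ≢ q
    fresh y∈ refl = let y∈ , y≢x = ∈-∖⁻ y∈
                    in y≢x (amo E (model E x∈) y∈ x∈ x⊨q (self E x∈))
    model′ : ∀ {y} → y ∈ q ∷ xs ∖ x → Model (β y) (eliminate x [ q ] φ)
    model′ {y} y∈ with y ≟ˡ q
    ... | yes _ = eliminate⁺ (λ _ → here x⊨q) (model E x∈)
    model′ (here e) | no y≢q = contradiction e y≢q
    model′ (there y∈) | no _ =
      let y∈ , y≢x = ∈-∖⁻ y∈
      in eliminate⁺ (λ p → contradiction (other E y∈ x∈ y≢x) (consistent p)) (model E y∈)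
    self′ : ∀ {y} → y ∈ q ∷ xs ∖ x → β y ⊨ y
    self′ {y} y∈ with y ≟ˡ q
    ... | yes refl = x⊨q
    self′ (here e) | no y≢q = contradiction e y≢q
    self′ (there y∈) | no _ = self E (proj₁ (∈-∖⁻ {xs} y∈))
    amo′ : ∀ {σ y z} → Model σ (eliminate x [ q ] φ) → y ∈ q ∷ xs ∖ x → z ∈ q ∷ xs ∖ x → σ ⊨ y → σ ⊨ z → y ≡ z
    amo′ {σ} m y∈ z∈ p r with σ ⊨? q
    amo′ {σ} m y∈ z∈ p r | yes σ⊨q = go y∈ z∈ p r
      where
      m′ = eliminate-true m σ⊨q (⊨⇒≢~ x⊨q (self E x∈)) q-in
      keep : ∀ {y} → y ∈ xs → σ ⊨ y → assign x σ ⊨ y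
      keep y∈ = assign-keep x (negation-free E 3≤ y∈ x∈)
      clash : ∀ {A : Set} {y} → y ∈ xs ∖ x → σ ⊨ y → A
      clash y∈ p = let y∈ , y≢x = ∈-∖⁻ y∈
                   in contradiction (amo E m′ y∈ x∈ (keep y∈ p) (assign-self x)) y≢x
      go : ∀ {y z} → y ∈ q ∷ xs ∖ x → z ∈ q ∷ xs ∖ x → σ ⊨ y → σ ⊨ z → y ≡ z
      go (here refl) (here refl) _ _ = refl
      go (there y∈) _ p _ = clash y∈ p
      go _ (there z∈) _ r = clash z∈ r
    amo′ m (here refl) _ p _ | no ¬q = contradiction p ¬q
    amo′ m _ (here refl) _ r | no ¬q = contradiction r ¬q
    amo′ {σ} m (there y∈) (there z∈) p r | no ¬q =
      amo E (eliminate-false m λ { (here q) → ¬q q })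
        (proj₁ (∈-∖⁻ {xs} y∈)) (proj₁ (∈-∖⁻ {xs} z∈)) (keep y∈ p) (keep z∈ r)
      where
      keep : ∀ {y} → y ∈ xs ∖ x → σ ⊨ y → assign (~ x) σ ⊨ y
      keep y∈ = assign-keep (~ x) (λ e → proj₂ (∈-∖⁻ {xs} y∈) (trans e (~-involutive x)))

  -- Together with `~ x ∈ C`, this makes `C` the clause `~ x ∨ l` up to order and repetition.
  Implication : Lit V → Lit V → Clause V → Set
  Implication x l C = l ∈ C × (∀ {l′} → l′ ∈ C → l′ ≡ ~ x ⊎ l′ ≡ l)

  Normal : CNF V → List (Lit V) → (Lit V → Assignment) → Set
  Normal φ xs α = ∀ {C x} → C ∈ φ → x ∈ xs → ~ x ∈ C → ∃ λ l → α x ⊨ l × Implication x l C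

  -- A clause with ~ x shrinks to {~ x , l} for some l that α x satisfies; all other models of
  -- interest satisfy ~ x.
  normalise : ∀ {φ xs α} → Encoding φ xs α →
    ∃ λ φ′ → length φ′ ≡ length φ × Encoding φ′ xs α × Normal φ′ xs α
  normalise {φ} {xs} {α} E = map f φ , length-map f φ , record
    { unique = unique E
    ; model  = λ x∈ → All.tabulate (λ C∈ → holds x∈ C∈)
    ; self   = self E
    ; amo    = λ m → amo E (All.tabulate (λ C∈ →
                 let l , l∈ , p = find (All.lookup m (∈-map⁺ f C∈)) in lose (proj₁ (f-spec C∈) l∈) p))
    } , normal
    where
    Shrinks : Clause V → Clause V → Set
    Shrinks C C′ = (∀ {l} → l ∈ C′ → l ∈ C) × (∀ {x} → x ∈ xs → Holds (α x) C′) ×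
      (∀ {x} → x ∈ xs → ~ x ∈ C′ → ∃ λ l → α x ⊨ l × Implication x l C′)
    shrink : ∀ {C} → C ∈ φ → ∃ (Shrinks C)
    shrink {C} C∈ with any? (λ x → ~ x ∈? C) xs
    ... | no none = C , id , (λ x∈ → All.lookup (model E x∈) C∈) , λ x∈ ~x∈ → contradiction (lose x∈ ~x∈) none
    ... | yes some with find some
    ... | x , x∈ , ~x∈ with find (All.lookup (model E x∈) C∈)
    ... | l , l∈ , x⊨l = ~ x ∷ l ∷ [] , sub , sats , binary
      where
      sub : ∀ {l′} → l′ ∈ ~ x ∷ l ∷ [] → l′ ∈ C
      sub (here refl) = ~x∈
      sub (there (here refl)) = l∈
      sats : ∀ {y} → y ∈ xs → Holds (α y) (~ x ∷ l ∷ [])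
      sats {y} y∈ with y ≟ˡ x
      ... | yes refl = there (here x⊨l)
      ... | no y≢x   = here (other E y∈ x∈ y≢x)
      binary : ∀ {y} → y ∈ xs → ~ y ∈ ~ x ∷ l ∷ [] → ∃ λ l′ → α y ⊨ l′ × Implication y l′ (~ x ∷ l ∷ [])
      binary {y} y∈ ~y∈ with y ≟ˡ x
      ... | yes refl = l , x⊨l , there (here refl) , λ { (here e) → inj₁ e ; (there (here e)) → inj₂ e }
      binary {y} y∈ (here e) | no y≢x = contradiction (trans (sym (~-involutive y)) (~-swap e)) y≢x
      -- Here `l` is itself `~ y`, so for `y` the roles of the two literals are swapped.
      binary {y} y∈ (there (here refl)) | no y≢x =
        ~ x , other E y∈ x∈ y≢x , here refl , λ { (here e) → inj₂ e ; (there (here e)) → inj₁ e }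
    -- Shrinking becomes a function of the clause, to be mapped over `φ`. Clauses may become equal,
    -- but the list keeps its length.
    chosen = Delete.choice (≡-dec _≟ˡ_) [] φ shrink
    f = proj₁ chosen
    f-spec = proj₂ chosen
    holds : ∀ {x C} → x ∈ xs → C ∈ map f φ → Holds (α x) C
    holds x∈ C∈ with ∈-map⁻ f C∈
    ... | C , C∈ , refl = proj₁ (proj₂ (f-spec C∈)) x∈
    normal : Normal (map f φ) xs α
    normal C∈ with ∈-map⁻ f C∈
    ... | C , C∈ , refl = proj₂ (proj₂ (f-spec C∈))

  -- Clauses falsified by making a second input true

  module _ {φ xs α} (E : Encoding φ xs α) (3≤ : 3 ≤ length xs) where

    -- In `α k`, making `x` and `ls` true leaves `k` true. Two inputs then hold, so the result is
    -- not a model.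
    critical : ∀ {x k} ls → x ∈ xs → k ∈ xs → x ≢ k → All (α x ⊨_) ls → ~ k ∉ ls →
      ∃ λ C → C ∈ φ × ¬ Holds (assignAll (x ∷ ls) (α k)) C
    critical {x} {k} ls x∈ k∈ x≢k x⊨ls ~k∉ = falsified-clause λ m → x≢k (amo E m x∈ k∈
      (assign-self x)
      (assign-keep x (negation-free E 3≤ k∈ x∈) (assignAll-keep ls ~k∉ (self E k∈))))

    -- Only `x` is flipped, so the falsified clause was true in `α k` through `~ x` alone.
    critical-clause : ∀ {x k} → x ∈ xs → k ∈ xs → x ≢ k →
      ∃ λ C → C ∈ φ × ~ x ∈ C × (∀ {l} → l ∈ C → α k ⊨ l → l ≡ ~ x)
    critical-clause {x} {k} x∈ k∈ x≢k with critical [] x∈ k∈ x≢k [] (λ ())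
    ... | C , C∈ , ¬C = C , C∈ , ~x∈ , only
      where
      only : ∀ {l} → l ∈ C → α k ⊨ l → l ≡ ~ x
      only {l} l∈ p = decidable-stable (l ≟ˡ ~ x) λ l≢ → ¬C (lose l∈ (assign-keep x l≢ p))
      ~x∈ : ~ x ∈ C
      ~x∈ = let l , l∈ , p = find (All.lookup (model E k∈) C∈) in subst (_∈ C) (only l∈ p) l∈

    negation-occurs : ∀ {x} → x ∈ xs → ∃ λ C → C ∈ φ × ~ x ∈ C
    negation-occurs {x} x∈ =
      let k , k∈ , k≢x , _ = third (unique E) 3≤ x x
          C , C∈ , ~x∈ , _ = critical-clause x∈ k∈ (≢-sym k≢x)
      in C , C∈ , ~x∈

  -- The regular case: two clauses of its own for each input

  occurrences : Lit V → CNF V → ℕ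
  occurrences l = count (l ∈?_)

  -- The clauses with `~ x` say that `x` implies `p` and `q`, which are allowed to coincide.
  record Partners (φ : CNF V) (α : Lit V → Assignment) (x : Lit V) (pq : Lit V × Lit V) : Set where
    p = proj₁ pq
    q = proj₂ pq
    field
      p-true   : α x ⊨ p
      q-true   : α x ⊨ q
      p-clause : ∃ λ C → C ∈ φ × ~ x ∈ C × p ∈ C
      q-clause : ∃ λ C → C ∈ φ × ~ x ∈ C × q ∈ C
      covers   : ∀ {C} → C ∈ φ → ~ x ∈ C → Implication x p C ⊎ Implication x q C

  partners : ∀ {φ xs α x} → Normal φ xs α → x ∈ xs → occurrences (~ x) φ ≡ 2 → ∃ (Partners φ α x)
  partners {φ} {x = x} normal x∈ two with filter (~ x ∈?_) φ in eq
  ... | C ∷ D ∷ [] =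
    let C∈ , ~x∈C = ∈-filter⁻ (~ x ∈?_) (subst (C ∈_) (sym eq) (here refl))
        D∈ , ~x∈D = ∈-filter⁻ (~ x ∈?_) (subst (D ∈_) (sym eq) (there (here refl)))
        p , x⊨p , impC = normal C∈ x∈ ~x∈C
        q , x⊨q , impD = normal D∈ x∈ ~x∈D
    in (p , q) , record
      { p-true   = x⊨p
      ; q-true   = x⊨q
      ; p-clause = C , C∈ , ~x∈C , proj₁ impC
      ; q-clause = D , D∈ , ~x∈D , proj₁ impD
      ; covers   = λ C′∈ ~x∈ → which impC impD (subst (_ ∈_) eq (∈-filter⁺ (~ x ∈?_) C′∈ ~x∈))
      }
    where
    which : ∀ {p q C′} → Implication x p C → Implication x q D → C′ ∈ C ∷ D ∷ [] →
      Implication x p C′ ⊎ Implication x q C′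
    which impC impD (here refl) = inj₁ impC
    which impC impD (there (here refl)) = inj₂ impD

  NoNegation : List (Lit V) → Clause V → Set
  NoNegation xs C = All (λ x → ~ x ∉ C) xs

  noNegation? : ∀ xs → Decidable (NoNegation xs)
  noNegation? xs C = all? (λ x → ¬? (~ x ∈? C)) xs

  module Regular {φ xs α} (E : Encoding φ xs α) (3≤ : 3 ≤ length xs)
    (pq : Lit V → Lit V × Lit V) (P : ∀ {x} → x ∈ xs → Partners φ α x (pq x))
    (two : ∀ {x} → x ∈ xs → occurrences (~ x) φ ≡ 2)
    (separate : ∀ {C x y} → C ∈ φ → x ∈ xs → y ∈ xs → ~ x ∈ C → ~ y ∈ C → x ≡ y) where

    p q : Lit V → Lit V
    p = proj₁ ∘ pq
    q = proj₂ ∘ pq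

    core : CNF V
    core = filter (noNegation? xs) φ

    Pair : Lit V → Lit V → Set
    Pair x l = l ≡ p x ⊎ l ≡ q x

    pair? : ∀ l → Decidable (λ x → Pair x l)
    pair? l x = (l ≟ˡ p x) ⊎-dec (l ≟ˡ q x)

    pair-true : ∀ {x l} → x ∈ xs → Pair x l → α x ⊨ l
    pair-true x∈ (inj₁ refl) = Partners.p-true (P x∈)
    pair-true x∈ (inj₂ refl) = Partners.q-true (P x∈)

    pair-clause : ∀ {x l} → x ∈ xs → Pair x l → ∃ λ C → C ∈ φ × ~ x ∈ C × l ∈ C
    pair-clause x∈ (inj₁ refl) = Partners.p-clause (P x∈)
    pair-clause x∈ (inj₂ refl) = Partners.q-clause (P x∈)

    pair-of-clause : ∀ {x C} → x ∈ xs → C ∈ φ → ~ x ∈ C → ∃ λ l → Pair x l × Implication x l C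
    pair-of-clause {x} x∈ C∈ ~x∈ =
      [ (λ i → p x , inj₁ refl , i) , (λ i → q x , inj₂ refl , i) ]′ (Partners.covers (P x∈) C∈ ~x∈)

    -- A partner `~ y` of `x` shares a clause with `~ x`, so `y` is `x` by `separate`. But `α x`
    -- satisfies `x` and its partners.
    pair-not-input : ∀ {x y} → x ∈ xs → y ∈ xs → ¬ Pair x (~ y)
    pair-not-input x∈ y∈ l with pair-clause x∈ l
    ... | C , C∈ , ~x∈ , ~y∈ with separate C∈ x∈ y∈ ~x∈ ~y∈
    ... | refl = consistent (self E x∈) (pair-true x∈ l)

    -- In some clause with `~ x`, no other literal is true in `α k`. That clause contains a partner
    -- of `x`, which therefore fails in `α k`.
    pair-exclusive : ∀ {x k} → x ∈ xs → k ∈ xs → x ≢ k → ¬ (α k ⊨ p x × α k ⊨ q x)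
    pair-exclusive {x} {k} x∈ k∈ x≢k (k⊨p , k⊨q) with critical-clause E 3≤ x∈ k∈ x≢k
    ... | C , C∈ , ~x∈ , only with pair-of-clause x∈ C∈ ~x∈
    ... | l , l-pair , l∈ , _ = consistent (self E x∈) (subst (α x ⊨_) (only l∈ (k⊨ l-pair)) (pair-true x∈ l-pair))
      where
      k⊨ : ∀ {l} → Pair x l → α k ⊨ l
      k⊨ (inj₁ refl) = k⊨p
      k⊨ (inj₂ refl) = k⊨q

    -- C blocks the attempt to make x true in the model α k of k.
    Blocks : Lit V → Clause V → Lit V → Set
    Blocks k C x = ¬ Holds (assignAll (x ∷ p x ∷ q x ∷ []) (α k)) C

    blocks? : ∀ k C → Decidable (Blocks k C)
    blocks? k C x = ¬? (holds? (assignAll (x ∷ p x ∷ q x ∷ []) (α k)) C)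

    all-true : ∀ {x} → x ∈ xs → All (α x ⊨_) (x ∷ p x ∷ q x ∷ [])
    all-true x∈ = self E x∈ ∷ pair-true x∈ (inj₁ refl) ∷ pair-true x∈ (inj₂ refl) ∷ []

    blocked : ∀ {x k} → x ∈ xs → k ∈ xs → x ≢ k → ∃ λ C → C ∈ φ × Blocks k C x
    blocked {x} x∈ k∈ x≢k = critical E 3≤ (p x ∷ q x ∷ []) x∈ k∈ x≢k (All.tail (all-true x∈))
      λ { (here e) → pair-not-input x∈ k∈ (inj₁ e) ; (there (here e)) → pair-not-input x∈ k∈ (inj₂ e) }

    module _ {k C x} (k∈ : k ∈ xs) (C∈ : C ∈ φ) (x∈ : x ∈ xs) (b : Blocks k C x) where

      -- A clause with `~ x` contains a partner of `x`, which has been made true.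
      blocks-self : ~ x ∉ C
      blocks-self ~x∈ with pair-of-clause x∈ C∈ ~x∈
      ... | l , inj₁ refl , l∈ , _ = b (lose l∈ (assignAll-self (all-true x∈) (there (here refl))))
      ... | l , inj₂ refl , l∈ , _ = b (lose l∈ (assignAll-self (all-true x∈) (there (there (here refl)))))

      -- To become false, `l` must be the negation of `x`, `p x` or `q x`; `blocks-self` excludes
      -- `x`.
      blocks-pair : ∀ {l} → l ∈ C → α k ⊨ l → Pair x (~ l)
      blocks-pair {l} l∈ k⊨l = decidable-stable (pair? (~ l) x) λ ¬pair →
        b (lose l∈ (assignAll-keep (x ∷ p x ∷ q x ∷ [])
          (λ { (here e) → blocks-self (subst (_∈ C) (trans (sym (~-involutive l)) (cong ~_ e)) l∈)
             ; (there (here e)) → ¬pair (inj₁ e)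
             ; (there (there (here e))) → ¬pair (inj₂ e) })
          k⊨l))

      -- A literal `~ y` in `C` with `y ≢ k` is true in `α k`, so `y` is a partner of `x`. Then
      -- `α x` satisfies both inputs, so they are equal, against `blocks-self`.
      blocks-noNegation : NoNegation (xs ∖ k) C
      blocks-noNegation = All.tabulate λ {y} y∈∖ ~y∈ →
        let y∈ , y≢k = ∈-∖⁻ {xs} y∈∖
            pair = subst (Pair x) (~-involutive y) (blocks-pair ~y∈ (other E k∈ y∈ (≢-sym y≢k)))
            x≡y = amo E (model E x∈) x∈ y∈ (self E x∈) (pair-true x∈ pair)
        in blocks-self (subst (λ z → ~ z ∈ C) (sym x≡y) ~y∈)

    -- If `l` is a partner of at least three inputs, fix one of them, `k`, and let `S` be the
    -- others. Each member of `S` is blocked in `α k` by a core clause, and each core clause blocks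
    -- at most one of them, so `S` is no longer than the core.
    degree : ∀ l → count (pair? l) xs ≤ 2 ⊔ suc (length core)
    degree l with filter (pair? l) xs in eq | Unique.filter⁺ (pair? l) (unique E)
    ... | [] | _ = z≤n {2 ⊔ suc (length core)}
    ... | _ ∷ [] | _ = s≤s (z≤n {1 ⊔ length core})
    ... | _ ∷ _ ∷ [] | _ = m≤m⊔n 2 (suc (length core))
    ... | k ∷ i₀ ∷ j₀ ∷ rest | k∉ ∷ u@((i₀≢j₀ ∷ _) ∷ _) =
      ≤-trans (s≤s (≤-trans (cover (blocks? k) 1 core S hit one) (≤-reflexive (*-identityʳ (length core)))))
        (m≤n⊔m 2 (suc (length core)))
      where
      S = i₀ ∷ j₀ ∷ rest
      member : ∀ {x} → x ∈ k ∷ S → x ∈ xs × Pair x l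
      member x∈ = ∈-filter⁻ (pair? l) {xs = xs} (subst (_ ∈_) (sym eq) x∈)
      k∈ = proj₁ (member (here refl))
      k⊨l = pair-true k∈ (proj₂ (member (here refl)))
      ≢k : ∀ {x} → x ∈ S → k ≢ x
      ≢k = All.lookup k∉
      exclusive : ∀ {x y m} → x ∈ k ∷ S → y ∈ k ∷ S → x ≢ y → m ≢ l → Pair x m → ¬ α y ⊨ m
      -- `α y` satisfies the common partner `l`, so by `pair-exclusive` it falsifies the other
      -- partner of `x`.
      exclusive {x} {y} {m} x∈ y∈ x≢y m≢l xm y⊨m = clash (proj₂ (member x∈)) xm
        where
        y⊨l = pair-true (proj₁ (member y∈)) (proj₂ (member y∈))
        both = pair-exclusive (proj₁ (member x∈)) (proj₁ (member y∈)) x≢y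
        clash : Pair x l → Pair x m → ⊥
        clash (inj₁ refl) (inj₁ e) = m≢l e
        clash (inj₂ refl) (inj₂ e) = m≢l e
        clash (inj₁ refl) (inj₂ refl) = both (y⊨l , y⊨m)
        clash (inj₂ refl) (inj₁ refl) = both (y⊨m , y⊨l)
      same-pair : ∀ {x y m} → x ∈ k ∷ S → y ∈ k ∷ S → m ≢ l → Pair x m → Pair y m → x ≡ y
      same-pair {x} {y} x∈ y∈ m≢l xm ym = decidable-stable (x ≟ˡ y) λ x≢y →
        exclusive x∈ y∈ x≢y m≢l xm (pair-true (proj₁ (member y∈)) ym)
      -- As `l` is already true in `α k`, a literal `m` true there can only be lost to the other
      -- partner, and by `same-pair` that partner identifies the blocked input.
      witness : ∀ {C} → C ∈ φ → ∃ λ m → m ∈ C × α k ⊨ m × ~ m ≢ l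
      witness C∈ with find (All.lookup (model E k∈) C∈)
      ... | m , m∈ , k⊨m = m , m∈ , k⊨m , λ e → consistent k⊨m (subst (α k ⊨_) (sym e) k⊨l)
      other-element : ∀ x → ∃ λ y → y ∈ S × y ≢ x
      other-element x with i₀ ≟ˡ x
      ... | no ne    = i₀ , here refl , ne
      ... | yes refl = j₀ , there (here refl) , ≢-sym i₀≢j₀
      one : ∀ {C} → C ∈ core → count (blocks? k C) S ≤ 1
      one {C} C∈core = unique-equal⇒≤1 (Unique.filter⁺ (blocks? k C) u) λ x∈ y∈ →
        let C∈ = proj₁ (∈-filter⁻ (noNegation? xs) {xs = φ} C∈core)
            m , m∈ , k⊨m , ~m≢l = witness C∈
            x∈S , bx = ∈-filter⁻ (blocks? k C) {xs = S} x∈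
            y∈S , by = ∈-filter⁻ (blocks? k C) {xs = S} y∈
        in same-pair (there x∈S) (there y∈S) ~m≢l
             (blocks-pair k∈ C∈ (proj₁ (member (there x∈S))) bx m∈ k⊨m)
             (blocks-pair k∈ C∈ (proj₁ (member (there y∈S))) by m∈ k⊨m)
      -- A blocking clause ~ k ∨ m would need m and ~ m to be partners of l for k and x; then no third
      -- input with partner l has a model.
      not-k : ∀ {C x} → x ∈ S → C ∈ φ → Blocks k C x → ~ k ∉ C
      not-k {C} {x} x∈S C∈ b ~k∈ with pair-of-clause k∈ C∈ ~k∈
      ... | m , km , m∈ , _ = impossible
        where
        x∈ = proj₁ (member (there x∈S))
        k⊨m = pair-true k∈ km
        x-pair : Pair x (~ m)
        x-pair = blocks-pair k∈ C∈ x∈ b m∈ k⊨m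
        x⊨l = pair-true x∈ (proj₂ (member (there x∈S)))
        m≢l : m ≢ l
        m≢l refl = consistent x⊨l (pair-true x∈ x-pair)
        ~m≢l : ~ m ≢ l
        ~m≢l e = consistent k⊨m (subst (α k ⊨_) (sym e) k⊨l)
        impossible : ⊥
        impossible =
          let y , y∈S , y≢x = other-element x
          in exclusive (there x∈S) (there y∈S) (≢-sym y≢x) ~m≢l x-pair
               (complete m (exclusive (here refl) (there y∈S) (≢k y∈S) m≢l km))
      hit : ∀ {x} → x ∈ S → ∃ λ C → C ∈ core × Blocks k C x
      hit {x} x∈S =
        let x∈ = proj₁ (member (there x∈S))
            C , C∈ , b = blocked x∈ k∈ (≢-sym (≢k x∈S))
            none = All.tabulate λ {y} y∈ ~y∈ → case-≟ (y ≟ˡ k)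
              (λ y≡k → not-k x∈S C∈ b (subst (λ z → ~ z ∈ C) y≡k ~y∈))
              (λ y≢k → All.lookup (blocks-noNegation k∈ C∈ x∈ b) (∈-∖⁺ y∈ y≢k) ~y∈)
        in C , ∈-filter⁺ (noNegation? xs) C∈ none , b
        where
        case-≟ : {A B : Set} → Dec A → (A → B) → (¬ A → B) → B
        case-≟ (yes a) f _ = f a
        case-≟ (no ¬a) _ g = g ¬a

    -- By `separate`, the two clauses with `~ y` contain no negation of an input in `ys`. So adding
    -- `y` takes two clauses away from those free of negations.
    size-bound : ∀ {ys} → Unique ys → (∀ {y} → y ∈ ys → y ∈ xs) →
      2 * length ys + count (noNegation? ys) φ ≤ length φ
    size-bound {[]} _ _ = ≤-reflexive (cong length (filter-all (noNegation? []) {φ} (All.tabulate λ _ → [])))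
    size-bound {y ∷ ys} (y∉ ∷ u) sub = begin
      2 * suc (length ys) + count (noNegation? (y ∷ ys)) φ
        ≡⟨ cong (_+ count (noNegation? (y ∷ ys)) φ) (trans (*-suc 2 (length ys)) (+-comm 2 (2 * length ys))) ⟩
      2 * length ys + 2 + count (noNegation? (y ∷ ys)) φ
        ≡⟨ +-assoc (2 * length ys) 2 _ ⟩
      2 * length ys + (2 + count (noNegation? (y ∷ ys)) φ)
        ≡⟨ cong (λ t → 2 * length ys + (t + count (noNegation? (y ∷ ys)) φ)) (two (sub (here refl))) ⟨
      2 * length ys + (occurrences (~ y) φ + count (noNegation? (y ∷ ys)) φ)
        ≤⟨ +-monoʳ-≤ (2 * length ys) (count-disjoint (~ y ∈?_) (noNegation? (y ∷ ys)) (noNegation? ys) φ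
             (λ C∈ ~y∈ → All.tabulate λ {z} z∈ ~z∈ →
               All.lookup y∉ z∈ (separate C∈ (sub (here refl)) (sub (there z∈)) ~y∈ ~z∈))
             (λ _ → All.tail)
             (λ _ ~y∈ none → All.head none ~y∈)) ⟩
      2 * length ys + count (noNegation? ys) φ
        ≤⟨ size-bound u (sub ∘ there) ⟩
      length φ ∎
      where open ≤-Reasoning

    regular-bound : Bound (length xs) (length φ)
    regular-bound =
      let k , k∈ = nonempty 3≤
      in bound-regular (length core) (size-bound (unique E) id) (≤-trans (length-∖ k (unique E)) (s≤s (others k∈)))
      where
      others : ∀ {k} → k ∈ xs → length (xs ∖ k) ≤ (2 + length core) * (2 ⊔ suc (length core))
      others {k} k∈ = ≤-trans
        (cover (blocks? k) D cs (xs ∖ k) hit bound)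
        (*-monoˡ-≤ D (subst (λ t → length cs ≤ t + length core) (two k∈)
          (count-⊎ (~ k ∈?_) (noNegation? xs) (noNegation? (xs ∖ k)) φ split)))
        where
        D = 2 ⊔ suc (length core)
        -- These are core clauses or clauses with `~ k`, hence at most `2 + length core` in number.
        cs = filter (noNegation? (xs ∖ k)) φ
        split : ∀ {C} → C ∈ φ → NoNegation (xs ∖ k) C → ~ k ∈ C ⊎ NoNegation xs C
        split {C} _ none with ~ k ∈? C
        ... | yes ~k∈ = inj₁ ~k∈
        ... | no ~k∉ = inj₂ (All.tabulate λ {y} y∈ ~y∈ →
          All.lookup none (∈-∖⁺ y∈ λ { refl → ~k∉ ~y∈ }) ~y∈)
        hit : ∀ {x} → x ∈ xs ∖ k → ∃ λ C → C ∈ cs × Blocks k C x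
        hit x∈∖ =
          let x∈ , x≢k = ∈-∖⁻ {xs} x∈∖
              C , C∈ , b = blocked x∈ k∈ x≢k
          in C , ∈-filter⁺ (noNegation? (xs ∖ k)) C∈ (blocks-noNegation k∈ C∈ x∈ b) , b
        bound : ∀ {C} → C ∈ cs → count (blocks? k C) (xs ∖ k) ≤ D
        bound {C} C∈cs =
          let C∈ = proj₁ (∈-filter⁻ (noNegation? (xs ∖ k)) {xs = φ} C∈cs)
              -- One literal of `C` true in `α k` is enough: every input that `C` blocks has `~ l`
              -- as a partner.
              l , l∈ , k⊨l = find (All.lookup (model E k∈) C∈)
          in begin
            count (blocks? k C) (xs ∖ k)     ≤⟨ count-mono (blocks? k C) (pair? (~ l)) (xs ∖ k) (λ x∈∖ b →
                                                  blocks-pair k∈ C∈ (proj₁ (∈-∖⁻ {xs} x∈∖)) b l∈ k⊨l) ⟩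
            count (pair? (~ l)) (xs ∖ k)     ≤⟨ count-filter (pair? (~ l)) _ xs ⟩
            count (pair? (~ l)) xs           ≤⟨ degree (~ l) ⟩
            D                                ∎
          where open ≤-Reasoning

  -- Induction on the number of clauses

  eliminated : ∀ {x} D φ → occurrences (~ x) φ + length (eliminate x D φ) ≡ length φ
  eliminated {x} D φ = trans (cong (occurrences (~ x) φ +_) (length-eliminate D φ)) (count-complement (~ x ∈?_) φ)

  occurs⇒positive : ∀ {l φ C} → C ∈ φ → l ∈ C → 1 ≤ occurrences l φ
  occurs⇒positive {l} C∈ l∈ = ∈-length (∈-filter⁺ (l ∈?_) C∈ l∈)

  module Step {φ xs α} (E : Encoding φ xs α) (3≤ : 3 ≤ length xs) (normal : Normal φ xs α)
    (IH : ∀ {ψ ys β} → length ψ < length φ → Encoding ψ ys β → Bound (length ys) (length ψ)) where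

    many : ∀ {x} → x ∈ xs → 3 ≤ occurrences (~ x) φ → Bound (length xs) (length φ)
    many {x} x∈ 3≤occ = bound-weaken (length-∖ x (unique E)) smaller
      (bound-suc (IH (≤-trans (m≤n+m _ 2) smaller) (drop-input E x∈)))
      where
      smaller : 3 + length (eliminate x [] φ) ≤ length φ
      smaller = ≤-trans (+-monoˡ-≤ _ 3≤occ) (≤-reflexive (eliminated [] φ))

    -- The replacement removes a clause without reducing the number of inputs, so the induction
    -- hypothesis needs no `bound-suc`.
    one : ∀ {x} → x ∈ xs → occurrences (~ x) φ ≡ 1 → Bound (length xs) (length φ)
    one {x} x∈ occ≡1 with filter (~ x ∈?_) φ in eq
    ... | C ∷ [] =
      let C∈ , ~x∈ = ∈-filter⁻ (~ x ∈?_) (subst (C ∈_) (sym eq) (here refl))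
          l , x⊨l , l∈ , _ = normal C∈ x∈ ~x∈
          _ , E′ = replace-input E 3≤ x∈ x⊨l λ C′∈ ~x∈′ → only l∈ (subst (_ ∈_) eq (∈-filter⁺ (~ x ∈?_) C′∈ ~x∈′))
      in bound-weaken (length-∖ x (unique E)) (<⇒≤ (smaller l)) (IH (smaller l) E′)
      where
      only : ∀ {l C′} → l ∈ C → C′ ∈ [ C ] → l ∈ C′
      only l∈ (here refl) = l∈
      smaller : ∀ l → length (eliminate x [ l ] φ) < length φ
      smaller l = ≤-reflexive (trans
        (cong (_+ length (eliminate x [ l ] φ)) (sym (cong length eq))) (eliminated [ l ] φ))

    shared : ∀ {x z C} → 4 ≤ length xs → (∀ {y} → y ∈ xs → occurrences (~ y) φ ≡ 2) →
      x ∈ xs → z ∈ xs → x ≢ z → C ∈ φ → ~ x ∈ C → ~ z ∈ C → Bound (length xs) (length φ)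
    shared {x} {z} {C} 4≤ two x∈ z∈ x≢z C∈ ~x∈ ~z∈ = finish (remaining (proj₂ (partners normal z∈ (two z∈))))
      where
      φ₁ = eliminate x [] φ
      E₁ = drop-input E x∈
      z∈₁ = ∈-∖⁺ z∈ (≢-sym x≢z)
      3≤₁ : 3 ≤ length (xs ∖ x)
      3≤₁ = s≤s⁻¹ (≤-trans 4≤ (length-∖ x (unique E)))
      Remaining : Set
      Remaining = ∃ λ l → α z ⊨ l × (∀ {D} → D ∈ φ → ~ z ∈ D → ~ x ∉ D → l ∈ D)
      is-~x : ∀ {l} → Implication z l C → ~ x ≡ l
      is-~x (_ , binary) with binary ~x∈
      ... | inj₂ e = e
      ... | inj₁ e = contradiction (trans (sym (~-involutive x)) (trans (cong ~_ e) (~-involutive z))) x≢z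
      -- The partner of `z` in `C` is `~ x`, so the clauses of `z` that survive dropping `x` contain
      -- the other partner.
      remaining : ∀ {pq} → Partners φ α z pq → Remaining
      remaining P with Partners.covers P C∈ ~z∈
      ... | inj₁ i = _ , Partners.q-true P , λ D∈ ~z∈ ~x∉ →
        [ (λ j → contradiction (subst (_∈ _) (sym (is-~x i)) (proj₁ j)) ~x∉) , proj₁ ]′ (Partners.covers P D∈ ~z∈)
      ... | inj₂ i = _ , Partners.p-true P , λ D∈ ~z∈ ~x∉ →
        [ proj₁ , (λ j → contradiction (subst (_∈ _) (sym (is-~x i)) (proj₁ j)) ~x∉) ]′ (Partners.covers P D∈ ~z∈)
      finish : Remaining → Bound (length xs) (length φ)
      finish (l , z⊨l , l-in) = bound-weaken
        (≤-trans (length-∖ x (unique E)) (s≤s (length-∖ z (unique-∖ (unique E)))))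
        smaller
        (bound-suc (IH (≤-trans (m≤n+m _ 2) smaller) (proj₂ (replace-input E₁ 3≤₁ z∈₁ z⊨l l-in₁))))
        where
        l-in₁ : ∀ {D} → D ∈ φ₁ → ~ z ∈ D → l ∈ D
        l-in₁ D∈ ~z∈ with ∈-map⁻ (substitute x []) D∈
        ... | D , D∈ , refl with ∈-filter⁻ _ {xs = φ} D∈
        ... | D∈ , ~x∉ = ∈-substitute (l-in D∈ (substitute-⊆ ~z∈) ~x∉)
          λ { refl → consistent z⊨l (other E z∈ x∈ (≢-sym x≢z)) }
        -- Dropping `x` removes two clauses. At least three inputs remain, so by `negation-occurs`
        -- some clause with `~ z` is left to be the third.
        smaller : 3 + length (eliminate z [ l ] φ₁) ≤ length φ
        smaller = begin
          3 + length (eliminate z [ l ] φ₁)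
            ≤⟨ +-monoʳ-≤ 2 (+-monoˡ-≤ _ (let _ , D∈ , ~z∈ = negation-occurs E₁ 3≤₁ z∈₁ in occurs⇒positive D∈ ~z∈)) ⟩
          2 + (occurrences (~ z) φ₁ + length (eliminate z [ l ] φ₁))
            ≡⟨ cong (2 +_) (eliminated [ l ] φ₁) ⟩
          2 + length φ₁
            ≡⟨ cong (_+ length φ₁) (two x∈) ⟨
          occurrences (~ x) φ + length φ₁
            ≡⟨ eliminated [] φ ⟩
          length φ ∎
          where open ≤-Reasoning

    exactly-two : (∀ {x} → x ∈ xs → occurrences (~ x) φ ≡ 2) → Bound (length xs) (length φ)
    exactly-two two with 4 ≤? length xs
    -- With three inputs, the two clauses of one of them suffice: `Bound 3 2` holds with `u = 1`, as
    -- 6 + 1 = 2 + 5.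
    ... | no ¬4≤ =
      let k , k∈ = nonempty 3≤
      in bound-weaken (s≤s⁻¹ (≰⇒> ¬4≤))
           (≤-trans (≤-reflexive (sym (two k∈))) (m+n≤o⇒m≤o _ (≤-reflexive (eliminated [] φ))))
           (1 , ≤-refl , inj₁ ≤-refl)
    ... | yes 4≤ with any? (λ x → any? (λ z → ¬? (x ≟ˡ z) ×-dec any? (λ C → (~ x ∈? C) ×-dec (~ z ∈? C)) φ) xs) xs
    ... | yes some =
      let x , x∈ , some′ = find some
          z , z∈ , x≢z , some″ = find some′
          C , C∈ , ~x∈ , ~z∈ = find some″
      in shared 4≤ two x∈ z∈ x≢z C∈ ~x∈ ~z∈
    ... | no none =
      let pq , P = choice default xs (λ x∈ → partners normal x∈ (two x∈))
      in Regular.regular-bound E 3≤ pq P two λ {_} {x} {y} C∈ x∈ y∈ ~x∈ ~y∈ →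
           decidable-stable (x ≟ˡ y) λ x≢y → none (lose x∈ (lose y∈ (x≢y , lose C∈ (~x∈ , ~y∈))))
      where
      default : Lit V × Lit V
      default = let k , _ = nonempty {xs = xs} 3≤ in k , k

    step : Bound (length xs) (length φ)
    step with all? (λ x → occurrences (~ x) φ ≟ 2) xs
    ... | yes two = exactly-two (All.lookup two)
    ... | no ¬two with find (¬All⇒Any¬ (λ x → occurrences (~ x) φ ≟ 2) xs ¬two)
    ... | x , x∈ , ≢2 with occurrences (~ x) φ in eq
    ... | 0 = let _ , C∈ , ~x∈ = negation-occurs E 3≤ x∈
              in contradiction (subst (1 ≤_) eq (occurs⇒positive C∈ ~x∈)) λ ()
    ... | 1 = one x∈ eq
    ... | 2 = contradiction refl ≢2
    ... | suc (suc (suc _)) = many x∈ (subst (3 ≤_) (sym eq) (s≤s (s≤s (s≤s z≤n))))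

  -- The induction is on clauses since `one` keeps the number of inputs; `t` is a strict upper bound
  -- on the length.
  size-lower-bound : ∀ t {φ xs α} → length φ < t → Encoding φ xs α → Bound (length xs) (length φ)
  size-lower-bound (suc t) {φ} {xs} {α} (s≤s φ≤t) E with 3 ≤? length xs
  ... | no ¬3≤ = bound-small (s≤s⁻¹ (≰⇒> ¬3≤))
  ... | yes 3≤ =
    let φ′ , same , E′ , normal = normalise E
    in subst (Bound (length xs)) same (Step.step E′ 3≤ normal
         (λ ψ< → size-lower-bound t (≤-trans ψ< (≤-trans (≤-reflexive same) φ≤t))))

-- From `Encodes` to `Encoding`

join : ∀ {n m} → (Fin n → Bool) → (Fin m → Bool) → Var n m → Bool
join τ σ = [ τ , σ ]′

module _ {n m : ℕ} where

  private
    _≟ᵛ_ : DecidableEquality (Var n m)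
    _≟ᵛ_ = Sum.≡-dec Fin._≟_ Fin._≟_

  unrestrict-clause : ∀ {τ σ} (C : Clause (Var n m)) →
    Any (λ l → T (evalLit σ l)) (mapMaybe yLit C) → Holds _≟ᵛ_ (join τ σ) C
  unrestrict-clause (pos (inj₁ _) ∷ C) h = there (unrestrict-clause C h)
  unrestrict-clause (neg (inj₁ _) ∷ C) h = there (unrestrict-clause C h)
  unrestrict-clause (pos (inj₂ _) ∷ C) (here p) = here (sat p)
  unrestrict-clause (pos (inj₂ _) ∷ C) (there h) = there (unrestrict-clause C h)
  unrestrict-clause (neg (inj₂ _) ∷ C) (here p) = here (sat p)
  unrestrict-clause (neg (inj₂ _) ∷ C) (there h) = there (unrestrict-clause C h)

  satisfied-clause : ∀ {τ σ} (C : Clause (Var n m)) → Any (T ∘ satX τ) C → Holds _≟ᵛ_ (join τ σ) C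
  satisfied-clause (pos (inj₁ _) ∷ _) (here p) = here (sat p)
  satisfied-clause (neg (inj₁ _) ∷ _) (here p) = here (sat p)
  satisfied-clause (_ ∷ C) (there h) = there (satisfied-clause C h)

  -- In a clause that `τ` does not satisfy, every true literal is auxiliary and is kept by
  -- `mapMaybe yLit`.
  restrict-clause : ∀ {τ σ} (C : Clause (Var n m)) → any (satX τ) C ≡ false →
    Holds _≟ᵛ_ (join τ σ) C → Any (λ l → T (evalLit σ l)) (mapMaybe yLit C)
  restrict-clause {τ} (pos (inj₁ i) ∷ C) _ _ with τ i in eq
  restrict-clause (pos (inj₁ i) ∷ C) none (here (sat p)) | false rewrite eq = ⊥-elim p
  restrict-clause (pos (inj₁ i) ∷ C) none (there h) | false = restrict-clause C none h
  restrict-clause {τ} (neg (inj₁ i) ∷ C) _ _ with τ i in eq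
  restrict-clause (neg (inj₁ i) ∷ C) none (here (sat p)) | true rewrite eq = ⊥-elim p
  restrict-clause (neg (inj₁ i) ∷ C) none (there h) | true = restrict-clause C none h
  restrict-clause (pos (inj₂ _) ∷ C) none (here (sat p)) = here p
  restrict-clause (pos (inj₂ _) ∷ C) none (there h) = there (restrict-clause C none h)
  restrict-clause (neg (inj₂ _) ∷ C) none (here (sat p)) = here p
  restrict-clause (neg (inj₂ _) ∷ C) none (there h) = there (restrict-clause C none h)

  restrict⁻ : ∀ {τ σ} (φ : CNF (Var n m)) →
    All (Any (λ l → T (evalLit σ l))) (restrict φ τ) → Model _≟ᵛ_ (join τ σ) φ
  restrict⁻ [] _ = []
  restrict⁻ {τ} (C ∷ φ) h with any (satX τ) C in eq
  restrict⁻ {τ} (C ∷ φ) h       | true  = satisfied-clause C (Any.any⁻ (satX τ) C (subst T (sym eq) _)) ∷ restrict⁻ φ h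
  restrict⁻ (C ∷ φ) (c ∷ h) | false = unrestrict-clause C c ∷ restrict⁻ φ h

  restrict⁺ : ∀ {τ σ} (φ : CNF (Var n m)) →
    Model _≟ᵛ_ (join τ σ) φ → All (Any (λ l → T (evalLit σ l))) (restrict φ τ)
  restrict⁺ [] _ = []
  restrict⁺ {τ} (C ∷ φ) (c ∷ h) with any (satX τ) C in eq
  ... | true  = restrict⁺ φ h
  ... | false = restrict-clause C eq c ∷ restrict⁺ φ h

  input : Fin n → Lit (Var n m)
  input i = pos (inj₁ i)

  -- The model of an input extends the assignment under which that input alone is true.
  encodes⇒encoding : ∀ {φ : CNF (Var n m)} → Encodes φ AtMostOne →
    ∃ (Encoding _≟ᵛ_ φ (map input (allFin n)))
  encodes⇒encoding {φ} enc = α , record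
    { unique = Unique.map⁺ (λ { refl → refl }) (Unique.allFin⁺ n)
    ; model  = model′
    ; self   = self′
    ; amo    = amo′
    }
    where
    indicator : Fin n → Fin n → Bool
    indicator i j = does (i Fin.≟ j)
    indicator-self : ∀ i → indicator i i ≡ true
    indicator-self i = dec-true (i Fin.≟ i) refl
    indicator-amo : ∀ i → AtMostOne (indicator i)
    indicator-amo i j k p q = trans (sym (only j p)) (only k q)
      where
      only : ∀ j → indicator i j ≡ true → i ≡ j
      only j p with yes i≡j ← i Fin.≟ j = i≡j
    solution : ∀ i → Satisfiable (restrict φ (indicator i))
    solution i = Equivalence.to (enc (indicator i)) (indicator-amo i)
    α : Lit (Var n m) → Var n m → Bool
    α (pos (inj₁ i)) = join (indicator i) (proj₁ (solution i))
    -- A dummy value: `Encoding` only constrains `α` at inputs.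
    α _ = λ _ → false
    model′ : ∀ {x} → x ∈ map input (allFin n) → Model _≟ᵛ_ (α x) φ
    model′ x∈ with ∈-map⁻ input x∈
    ... | i , _ , refl = restrict⁻ φ (proj₂ (solution i))
    self′ : ∀ {x} → x ∈ map input (allFin n) → _⊨_ _≟ᵛ_ (α x) x
    self′ x∈ with ∈-map⁻ input x∈
    ... | i , _ , refl = sat (subst T (sym (indicator-self i)) _)
    amo′ : ∀ {σ x y} → Model _≟ᵛ_ σ φ → x ∈ map input (allFin n) → y ∈ map input (allFin n) →
      _⊨_ _≟ᵛ_ σ x → _⊨_ _≟ᵛ_ σ y → x ≡ y
    amo′ {σ} m x∈ y∈ p q with ∈-map⁻ input x∈ | ∈-map⁻ input y∈
    ... | i , _ , refl | j , _ , refl = cong input (at-most-one i j (truth p) (truth q))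
      where
      truth : ∀ {i} → _⊨_ _≟ᵛ_ σ (input i) → σ (inj₁ i) ≡ true
      truth (sat t) = Equivalence.to T-≡ t
      -- `σ` and the join of its halves agree only pointwise, so truth is transferred literal by
      -- literal.
      split : ∀ {C} → Holds _≟ᵛ_ σ C → Holds _≟ᵛ_ (join (σ ∘ inj₁) (σ ∘ inj₂)) C
      split = Any.map λ { {pos (inj₁ _)} (sat t) → sat t ; {pos (inj₂ _)} (sat t) → sat t
                        ; {neg (inj₁ _)} (sat t) → sat t ; {neg (inj₂ _)} (sat t) → sat t }
      at-most-one : AtMostOne (σ ∘ inj₁)
      at-most-one = Equivalence.from (enc (σ ∘ inj₁)) (σ ∘ inj₂ , restrict⁺ φ (All.map split m))

theorem2 : (n : ℕ) → 8 ≤ n → (m : ℕ) → (φ : CNF (Var n m)) → IsClauseSet φ → Encodes φ AtMostOne → AtLeastBound n (size φ)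
theorem2 n 8≤n m φ _ enc = bound⇒AtLeastBound 8≤n
  (subst (λ k → Bound k (length φ)) (trans (length-map input (allFin n)) (length-tabulate id))
    (size-lower-bound (Sum.≡-dec Fin._≟_ Fin._≟_) (suc (length φ)) ≤-refl (proj₂ (encodes⇒encoding {φ = φ} enc))))
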